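{- Let $\mathbb{U}=(U,\mathcal{B})$ and $\mathbb{U}'=(U',\mathcal{B}')$ be unitals of orders $q$ and $q'$, respectively. If $q>2$, then every graph isomorphism $\beta$ from the confluence graph of $\mathbb{U}$ to the confluence graph of $\mathbb{U}'$ extends to an isomorphism from $\mathbb{U}$ onto $\mathbb{U}'$; i.e., there is a bijection $\alpha\colon U\to U'$ such that $(\alpha,\beta)$ is an isomorphism of incidence structures ($x\in B$ iff $\alpha(x)\in\beta(B)$).
   Context: A unital of order $q>1$ (integer) is a $2$-$(q^3+1,q+1,1)$ design: a set of $q^3+1$ points with a family of blocks, each a $(q+1)$-subset, such that any two distinct points lie in exactly one common block. The confluence graph of a unital has the blocks as vertices, two distinct blocks being adjacent if they share a point. -}

module Defs where

open import Data.Nat using (ℕ; suc; _^_; _<_)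
open import Data.Fin using (Fin)
open import Data.Fin.Subset using (Subset; _∈_; ∣_∣)
open import Data.Product using (Σ; _×_; ∃; ∃!)
open import Relation.Binary.PropositionalEquality using (_≡_; _≢_)
open import Function.Bundles using (_⇔_)
open import Function.Definitions using (Bijective)

-- A unital of order q: a 2-(q^3+1, q+1, 1) design.
-- Points are Fin (q^3 + 1); the blocks are an indexed family of subsets
-- (indexed by Fin nb), each of size q+1, such that any two distinct points
-- lie in exactly one common block.  (Distinct indices automatically give
-- distinct point sets, since a block has q+1 ≥ 2 points.)
record Unital : Set where
  field
    q            : ℕ
    q>1          : 1 < q
    nb           : ℕ
    block        : Fin nb → Subset (suc (q ^ 3))
    block-size   : ∀ B → ∣ block B ∣ ≡ suc q
    unique-block : ∀ (x y : Fin (suc (q ^ 3))) → x ≢ y →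
                   ∃! _≡_ (λ B → x ∈ block B × y ∈ block B)

  Point : Set
  Point = Fin (suc (q ^ 3))

  Block : Set
  Block = Fin nb

  Adj : Block → Block → Set
  Adj B C = B ≢ C × ∃ (λ x → x ∈ block B × x ∈ block C)

open Unital

IsConfluenceIso : (U U' : Unital) → (Block U → Block U') → Set
IsConfluenceIso U U' β =
  Bijective _≡_ _≡_ β × (∀ B C → Adj U B C ⇔ Adj U' (β B) (β C))

IsIncidenceIso : (U U' : Unital) → (Point U → Point U') → (Block U → Block U') → Set
IsIncidenceIso U U' α β =
  Bijective _≡_ _≡_ α × Bijective _≡_ _≡_ β ×
  (∀ x B → (x ∈ block U B) ⇔ (α x ∈ block U' (β B)))

{-# OPTIONS --safe #-}

-- Let K be the image under β of the pencil of a point.  It is a clique of q² blocks, and every block outside K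
-- meets exactly q + 1 blocks of K.  Write r x for the number of blocks of K through x; the sum of r over a block
-- is q² + q or q + 1 according to whether the block belongs to K.  Suppose no point lies on all blocks of K.
-- Each point x is then avoided by a block of K, so r x ≤ q + 1, and the defects d x = q + 1 - r x add up to q +
-- 1 on every block of K.  Two points not joined by a block of K have r z + r x ≤ q + 1.  Playing this against
-- the sums of defects yields first a point p with d p = 0, then that no point has both r ≥ 2 and d ≥ 2, so that
-- points with d ≥ 2 have r = 1; but every block of K through p contains such a point, and for q > 2 two of them
-- on different blocks through p force too much defect. Hence images of pencils lie in pencils.  The same holds
-- for the inverse isomorphism, the orders being equal by comparing degrees of the confluence graphs, and the two
-- maps of points obtained are mutually inverse.
module Submission where

open import Defs
open import Data.Nat using (_<_)
open import Data.Product using (Σ)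

import Algebra.Properties.Semiring.Sum
open import Data.Bool using (true; false; if_then_else_)
open import Data.Empty using (⊥; ⊥-elim)
open import Data.Fin using (Fin; zero; suc; punchIn)
open import Data.Fin.Properties using (_≟_; any?; all?; ¬∀⟶∃¬; punchInᵢ≢i)
open import Data.Fin.Subset using (Subset; _∈_; _∉_; ∣_∣; ⊤; ⁅_⁆; inside; outside)
open import Data.Fin.Subset.Properties using (_∈?_; ∈⊤; ∣⊤∣≡n; x∈⁅x⁆; x∈⁅y⁆⇒x≡y)
open import Data.Nat using (ℕ; zero; suc; _+_; _*_; _∸_; _^_; _≤_; z≤n; s≤s; >-nonZero)
open import Data.Nat.Properties renaming (_≟_ to _≟ℕ_)
open import Data.Nat.Tactic.RingSolver using (solve-∀)
open import Data.Product using (_×_; _,_; proj₁; proj₂; ∃)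
open import Data.Sum using (_⊎_; inj₁; inj₂)
open import Data.Vec using ([]; _∷_; lookup; tabulate)
open import Data.Vec.Properties using ([]=⇒lookup; lookup⇒[]=; lookup∘tabulate)
open import Function using (_∘_)
open import Function.Bundles using (mk⇔; module Equivalence)
open import Function.Definitions using (Bijective)
open import Relation.Binary.Definitions using (tri<; tri≈; tri>)
open import Relation.Binary.PropositionalEquality
  using (_≡_; _≢_; refl; sym; trans; cong; cong₂; subst; subst₂; module ≡-Reasoning)
open import Relation.Nullary using (¬_; yes; no; contradiction)
open import Relation.Nullary.Decidable using (_×-dec_; _→-dec_; decidable-stable)

open Algebra.Properties.Semiring.Sum +-*-semiring
  using (sum; sum-cong-≗; sum-remove; ∑-distrib-+; ∑-comm; *-distribˡ-sum; *-distribʳ-sum)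

-- Sums of natural numbers over finite subsets.

private
  variable
    m n : ℕ

sum-mono : {f g : Fin n → ℕ} → (∀ i → f i ≤ g i) → sum f ≤ sum g
sum-mono {zero}  f≤g = z≤n
sum-mono {suc n} f≤g = +-mono-≤ (f≤g zero) (sum-mono (f≤g ∘ suc))

-- The summand at i is exchanged between the two sides rather than cancelled, which avoids subtraction.
sum-exchange-≤ : (f g : Fin n → ℕ) (i : Fin n) → (∀ j → j ≢ i → g j ≤ f j) →
                 sum g + f i ≤ sum f + g i
sum-exchange-≤ {suc n} f g i g≤f = begin
  sum g + f i                              ≡⟨ cong (_+ f i) (sum-remove {i = i} g) ⟩
  g i + sum (λ j → g (punchIn i j)) + f i  ≤⟨ +-monoˡ-≤ (f i) (+-monoʳ-≤ (g i) (sum-mono λ j → g≤f _ (punchInᵢ≢i i j))) ⟩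
  g i + sum (λ j → f (punchIn i j)) + f i  ≡⟨ lemma (g i) _ (f i) ⟩
  f i + sum (λ j → f (punchIn i j)) + g i  ≡⟨ cong (_+ g i) (sum-remove {i = i} f) ⟨
  sum f + g i                              ∎
  where
  open ≤-Reasoning
  lemma : ∀ a b c → a + b + c ≡ c + b + a
  lemma = solve-∀

χ : Subset n → Fin n → ℕ
χ p x = if lookup p x then 1 else 0

χ-∈ : {p : Subset n} {x : Fin n} → x ∈ p → χ p x ≡ 1
χ-∈ x∈p rewrite []=⇒lookup x∈p = refl

χ-∉ : {p : Subset n} {x : Fin n} → x ∉ p → χ p x ≡ 0
χ-∉ {p = p} {x} x∉p with lookup p x in eq
... | true  = contradiction (lookup⇒[]= x p eq) x∉p
... | false = refl

χ≤1 : (p : Subset n) (x : Fin n) → χ p x ≤ 1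
χ≤1 p x with lookup p x
... | true  = ≤-refl
... | false = z≤n

-- Membership enters as the weight `χ p x`, so every sum runs over all of `Fin n` and summations can
-- be interchanged freely.
∑∈ : Subset n → (Fin n → ℕ) → ℕ
∑∈ p f = sum λ x → χ p x * f x

∑∈-mono : (p : Subset n) {f g : Fin n → ℕ} → (∀ {x} → x ∈ p → f x ≤ g x) → ∑∈ p f ≤ ∑∈ p g
∑∈-mono p f≤g = sum-mono λ x → pointwise x
  where
  pointwise : ∀ x → χ p x * _ ≤ χ p x * _
  pointwise x with x ∈? p
  ... | yes x∈p = *-monoʳ-≤ (χ p x) (f≤g x∈p)
  ... | no  x∉p rewrite χ-∉ x∉p = z≤n

∑∈-cong : (p : Subset n) {f g : Fin n → ℕ} → (∀ {x} → x ∈ p → f x ≡ g x) → ∑∈ p f ≡ ∑∈ p g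
∑∈-cong p f≡g = ≤-antisym (∑∈-mono p (≤-reflexive ∘ f≡g)) (∑∈-mono p (≤-reflexive ∘ sym ∘ f≡g))

∑∈-+ : (p : Subset n) (f g : Fin n → ℕ) → ∑∈ p (λ x → f x + g x) ≡ ∑∈ p f + ∑∈ p g
∑∈-+ p f g = trans
  (sum-cong-≗ λ x → *-distribˡ-+ (χ p x) (f x) (g x))
  (∑-distrib-+ (λ x → χ p x * f x) (λ x → χ p x * g x))

∑∈-*ʳ : (p : Subset n) (f : Fin n → ℕ) (c : ℕ) → ∑∈ p (λ x → f x * c) ≡ ∑∈ p f * c
∑∈-*ʳ p f c = trans
  (sum-cong-≗ λ x → sym (*-assoc (χ p x) (f x) c))
  (sym (*-distribʳ-sum c (λ x → χ p x * f x)))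

∑∈-*ˡ : (p : Subset n) (c : ℕ) (f : Fin n → ℕ) → ∑∈ p (λ x → c * f x) ≡ c * ∑∈ p f
∑∈-*ˡ p c f = trans (∑∈-cong p λ _ → *-comm c _) (trans (∑∈-*ʳ p f c) (*-comm _ c))

∑∈-1 : (p : Subset n) → ∑∈ p (λ _ → 1) ≡ ∣ p ∣
∑∈-1 []            = refl
∑∈-1 (inside  ∷ p) = cong suc (∑∈-1 p)
∑∈-1 (outside ∷ p) = ∑∈-1 p

∑∈-const : (p : Subset n) (c : ℕ) → ∑∈ p (λ _ → c) ≡ ∣ p ∣ * c
∑∈-const p c = begin
  ∑∈ p (λ _ → c)      ≡⟨ ∑∈-cong p (λ _ → sym (*-identityˡ c)) ⟩
  ∑∈ p (λ _ → 1 * c)  ≡⟨ ∑∈-*ʳ p (λ _ → 1) c ⟩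
  ∑∈ p (λ _ → 1) * c  ≡⟨ cong (_* c) (∑∈-1 p) ⟩
  ∣ p ∣ * c           ∎
  where open ≡-Reasoning

sum-χ : (p : Subset n) → ∣ p ∣ ≡ sum (χ p)
sum-χ p = trans (sym (∑∈-1 p)) (sum-cong-≗ λ x → *-identityʳ (χ p x))

∑∈-⊤ : (f : Fin n → ℕ) → ∑∈ ⊤ f ≡ sum f
∑∈-⊤ f = sum-cong-≗ λ x → trans (cong (_* f x) (χ-∈ {x = x} ∈⊤)) (*-identityˡ (f x))

∑∈-0 : (p : Subset n) {f : Fin n → ℕ} → (∀ {x} → x ∈ p → f x ≡ 0) → ∑∈ p f ≡ 0
∑∈-0 p f≡0 = trans (∑∈-cong p f≡0) (trans (∑∈-const p 0) (*-zeroʳ ∣ p ∣))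

∑∈-comm : (p : Subset m) (q : Subset n) (f : Fin m → Fin n → ℕ) →
          ∑∈ p (λ x → ∑∈ q (f x)) ≡ ∑∈ q (λ y → ∑∈ p (λ x → f x y))
∑∈-comm {m} {n} p q f = begin
  sum (λ x → χ p x * sum (λ y → χ q y * f x y))
    ≡⟨ sum-cong-≗ (λ x → *-distribˡ-sum (χ p x) (λ y → χ q y * f x y)) ⟩
  sum (λ x → sum (λ y → χ p x * (χ q y * f x y)))
    ≡⟨ ∑-comm (λ x y → χ p x * (χ q y * f x y)) ⟩
  sum (λ y → sum (λ x → χ p x * (χ q y * f x y)))
    ≡⟨ sum-cong-≗ (λ y → sum-cong-≗ (λ x → swap (χ p x) (χ q y) (f x y))) ⟩
  sum (λ y → sum (λ x → χ q y * (χ p x * f x y)))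
    ≡⟨ sum-cong-≗ (λ y → *-distribˡ-sum (χ q y) (λ x → χ p x * f x y)) ⟨
  sum (λ y → χ q y * sum (λ x → χ p x * f x y)) ∎
  where
  open ≡-Reasoning
  swap : ∀ a b c → a * (b * c) ≡ b * (a * c)
  swap = solve-∀

∑∈-exchange-≤ : (p : Subset n) (f g : Fin n → ℕ) {x : Fin n} → x ∈ p →
                (∀ {y} → y ∈ p → y ≢ x → g y ≤ f y) → ∑∈ p g + f x ≤ ∑∈ p f + g x
∑∈-exchange-≤ p f g {x} x∈p g≤f =
  subst₂ _≤_ (cong (∑∈ p g +_) (at f)) (cong (∑∈ p f +_) (at g))
    (sum-exchange-≤ (λ y → χ p y * f y) (λ y → χ p y * g y) x pointwise)
  where
  at : ∀ h → χ p x * h x ≡ h x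
  at h rewrite χ-∈ x∈p = *-identityˡ (h x)
  pointwise : ∀ y → y ≢ x → χ p y * g y ≤ χ p y * f y
  pointwise y y≢x with y ∈? p
  ... | yes y∈p = *-monoʳ-≤ (χ p y) (g≤f y∈p y≢x)
  ... | no  y∉p rewrite χ-∉ y∉p = z≤n

∑∈-exchange : (p : Subset n) (f g : Fin n → ℕ) {x : Fin n} → x ∈ p →
              (∀ {y} → y ∈ p → y ≢ x → f y ≡ g y) → ∑∈ p g + f x ≡ ∑∈ p f + g x
∑∈-exchange p f g x∈p f≡g = ≤-antisym
  (∑∈-exchange-≤ p f g x∈p λ y∈p y≢x → ≤-reflexive (sym (f≡g y∈p y≢x)))
  (∑∈-exchange-≤ p g f x∈p λ y∈p y≢x → ≤-reflexive (f≡g y∈p y≢x))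

∑∈-single : (p : Subset n) (f : Fin n → ℕ) {x : Fin n} → x ∈ p →
            (∀ {y} → y ∈ p → y ≢ x → f y ≡ 0) → ∑∈ p f ≡ f x
∑∈-single p f {x} x∈p f≡0 = begin
  ∑∈ p f                    ≡⟨ +-identityʳ _ ⟨
  ∑∈ p f + 0                ≡⟨ ∑∈-exchange p f (λ _ → 0) x∈p f≡0 ⟨
  ∑∈ p (λ _ → 0) + f x      ≡⟨ cong (_+ f x) (∑∈-0 p λ _ → refl) ⟩
  f x                       ∎
  where open ≡-Reasoning

∑∈-term : (p : Subset n) (f : Fin n → ℕ) {x : Fin n} → x ∈ p → f x ≤ ∑∈ p f
∑∈-term p f {x} x∈p =
  subst₂ _≤_ (cong (_+ f x) (∑∈-0 p λ _ → refl)) (+-identityʳ _)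
    (∑∈-exchange-≤ p f (λ _ → 0) x∈p λ _ _ → z≤n)

∑∈-pair : (p : Subset n) (f : Fin n → ℕ) {x y : Fin n} → x ∈ p → y ∈ p → x ≢ y →
          f x + f y ≤ ∑∈ p f
∑∈-pair p f {x} {y} x∈p y∈p x≢y =
  subst₂ _≤_ (cong (_+ f y) ∑g≡fx) (trans (cong (∑∈ p f +_) gy≡0) (+-identityʳ _))
    (∑∈-exchange-≤ p f g y∈p λ {w} _ _ → g≤f w)
  where
  -- `g` keeps only the term of `f` at `x`, so exchanging `f` and `g` at `y` leaves `f x + f y` on
  -- the smaller side.
  g : _ → ℕ
  g w = χ ⁅ x ⁆ w * f w
  g≡0 : ∀ {w} → w ≢ x → g w ≡ 0
  g≡0 {w} w≢x rewrite χ-∉ {p = ⁅ x ⁆} {w} (w≢x ∘ x∈⁅y⁆⇒x≡y x) = refl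
  gy≡0 : g y ≡ 0
  gy≡0 = g≡0 (x≢y ∘ sym)
  g≤f : ∀ w → g w ≤ f w
  g≤f w = ≤-trans (*-monoˡ-≤ (f w) (χ≤1 ⁅ x ⁆ w)) (≤-reflexive (*-identityˡ (f w)))
  ∑g≡fx : ∑∈ p g ≡ f x
  ∑g≡fx = trans (∑∈-single p g x∈p λ _ → g≡0)
                (trans (cong (_* f x) (χ-∈ (x∈⁅x⁆ x))) (*-identityˡ (f x)))

∑∈-<-∃ : (p : Subset n) (f g : Fin n → ℕ) → ∑∈ p f < ∑∈ p g → ∃ λ x → x ∈ p × f x < g x
∑∈-<-∃ p f g f<g with any? (λ x → (x ∈? p) ×-dec (f x <? g x))
... | yes found = found
... | no  none  = contradiction (∑∈-mono p λ {x} x∈p → ≮⇒≥ λ fx<gx → none (x , x∈p , fx<gx)) (<⇒≱ f<g)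

-- The term at `x` is discounted on both sides, so the strict inequality compares the sums over the
-- other members of `p`.
∑∈-exchange-<-∃ : (p : Subset n) (f g : Fin n → ℕ) {x : Fin n} → x ∈ p →
                  ∑∈ p f + g x < ∑∈ p g + f x → ∃ λ y → y ∈ p × f y < g y
∑∈-exchange-<-∃ p f g x∈p f<g with any? (λ y → (y ∈? p) ×-dec (f y <? g y))
... | yes found = found
... | no  none  = contradiction
  (∑∈-exchange-≤ p f g x∈p λ {y} y∈p _ → ≮⇒≥ λ fy<gy → none (y , y∈p , fy<gy)) (<⇒≱ f<g)

-- Incidence counts in a unital.

module Design (V : Unital) where
  open Unital V

  meet : Block → Block → ℕ
  meet B C = ∑∈ (block B) (χ (block C))

  deg : Subset nb → Point → ℕ
  deg K x = ∑∈ K λ D → χ (block D) x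

  -- For distinct points this is 1 or 0 according to whether their joining block belongs to `K`; on
  -- the diagonal it is the degree.
  codeg : Subset nb → Point → Point → ℕ
  codeg K x y = ∑∈ K λ D → χ (block D) x * χ (block D) y

  -- Double counting of the incident pairs formed by a point of `C` and a block of `K`.
  ∑-deg : (K : Subset nb) (C : Block) → ∑∈ (block C) (deg K) ≡ ∑∈ K (meet C)
  ∑-deg K C = ∑∈-comm (block C) K λ x D → χ (block D) x

  ∑-codeg : (K : Subset nb) (x : Point) (P : Subset (suc (q ^ 3))) →
            ∑∈ P (codeg K x) ≡ ∑∈ K (λ D → χ (block D) x * ∑∈ P (χ (block D)))
  ∑-codeg K x P = trans
    (∑∈-comm P K λ y D → χ (block D) x * χ (block D) y)
    (∑∈-cong K λ {D} _ → ∑∈-*ˡ P (χ (block D) x) (χ (block D)))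

  ∑-χ : (p : Subset (suc (q ^ 3))) → ∑∈ p (χ p) ≡ ∣ p ∣
  ∑-χ p = trans (∑∈-cong p χ-∈) (∑∈-1 p)

  through : {x y : Point} → x ≢ y → ∃ λ B → x ∈ block B × y ∈ block B
  through x≢y with unique-block _ _ x≢y
  ... | B , on , _ = B , on

  unique : {x y : Point} {B C : Block} → x ≢ y →
           x ∈ block B → y ∈ block B → x ∈ block C → y ∈ block C → B ≡ C
  unique x≢y xB yB xC yC with unique-block _ _ x≢y
  ... | _ , _ , only = trans (sym (only (xB , yB))) (only (xC , yC))

  χ*χ≡1 : {x y : Point} {D : Block} → x ∈ block D → y ∈ block D → χ (block D) x * χ (block D) y ≡ 1
  χ*χ≡1 xD yD = cong₂ _*_ (χ-∈ xD) (χ-∈ yD)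

  χ*χ≡0 : {x y : Point} {D : Block} → ¬ (x ∈ block D × y ∈ block D) → χ (block D) x * χ (block D) y ≡ 0
  χ*χ≡0 {x} {y} {D} ¬both with x ∈? block D
  ... | no  x∉D rewrite χ-∉ x∉D = refl
  ... | yes x∈D rewrite χ-∉ {p = block D} {y} (λ y∈D → ¬both (x∈D , y∈D)) = *-zeroʳ (χ (block D) x)

  codeg≡1 : {K : Subset nb} {x y : Point} {B : Block} → x ≢ y → B ∈ K →
            x ∈ block B → y ∈ block B → codeg K x y ≡ 1
  codeg≡1 {K} x≢y B∈K xB yB = trans
    (∑∈-single K _ B∈K λ _ D≢B → χ*χ≡0 λ (xD , yD) → D≢B (unique x≢y xD yD xB yB))
    (χ*χ≡1 xB yB)

  codeg≤1 : {K : Subset nb} {x y : Point} → x ≢ y → codeg K x y ≤ 1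
  codeg≤1 {K} x≢y with through x≢y
  ... | B , xB , yB with B ∈? K
  ...   | yes B∈K = ≤-reflexive (codeg≡1 x≢y B∈K xB yB)
  ...   | no  B∉K = ≤-trans (≤-reflexive (∑∈-0 K λ D∈K → χ*χ≡0 λ (xD , yD) →
                      B∉K (subst (_∈ K) (unique x≢y xD yD xB yB) D∈K))) z≤n

  -- Of the at least two blocks of `K` through `x`, at most one also passes through `y`.
  separating : (K : Subset nb) {x y : Point} → x ≢ y → 2 ≤ deg K x →
               ∃ λ C → C ∈ K × x ∈ block C × y ∉ block C
  separating K {x} {y} x≢y deg≥2
    with ∑∈-<-∃ K (λ D → χ (block D) x * χ (block D) y) (λ D → χ (block D) x)
           (≤-<-trans (codeg≤1 {K} x≢y) deg≥2)
  ... | C , C∈K , lt with x ∈? block C | y ∈? block C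
  ...   | no  x∉C | _       rewrite χ-∉ x∉C = contradiction lt λ ()
  ...   | yes x∈C | no y∉C  = C , C∈K , x∈C , y∉C
  ...   | yes x∈C | yes y∈C rewrite χ-∈ x∈C | χ-∈ y∈C = contradiction lt (n≮n 1)

  codeg-diag : (K : Subset nb) (x : Point) → codeg K x x ≡ deg K x
  codeg-diag K x = ∑∈-cong K λ {D} _ → idem D
    where
    idem : ∀ D → χ (block D) x * χ (block D) x ≡ χ (block D) x
    idem D with x ∈? block D
    ... | yes x∈D rewrite χ-∈ x∈D = refl
    ... | no  x∉D rewrite χ-∉ x∉D = refl

  meet≡1 : {B C : Block} {x : Point} → B ≢ C → x ∈ block B → x ∈ block C → meet B C ≡ 1
  meet≡1 {B} B≢C xB xC = trans
    (∑∈-single (block B) _ xB λ yB y≢x → χ-∉ λ yC → B≢C (unique y≢x yB xB yC xC))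
    (χ-∈ xC)

  meet≡0 : {B C : Block} → ¬ (∃ λ x → x ∈ block B × x ∈ block C) → meet B C ≡ 0
  meet≡0 {B} disjoint = ∑∈-0 (block B) λ xB → χ-∉ λ xC → disjoint (_ , xB , xC)

  meet-diag : (B : Block) → meet B B ≡ suc q
  meet-diag B = trans (∑-χ (block B)) (block-size B)

  -- Pairs of a block through `x` and a point on it are counted twice: each block has `q + 1`
  -- points, while `x` occurs `deg ⊤ x` times and each of the other `q ^ 3` points once.
  deg-⊤ : (x : Point) → deg ⊤ x ≡ q * q
  deg-⊤ x = *-cancelʳ-≡ (deg ⊤ x) (q * q) q {{>-nonZero (<-trans (s≤s z≤n) q>1)}}
    (+-cancelʳ-≡ (deg ⊤ x + 1) _ _ (begin
      deg ⊤ x * q + (deg ⊤ x + 1)             ≡⟨ shape₁ (deg ⊤ x) q ⟩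
      deg ⊤ x * suc q + 1                     ≡⟨ cong (_+ 1) flags ⟨
      ∑∈ points (codeg ⊤ x) + 1                    ≡⟨ ∑∈-exchange points (codeg ⊤ x) (λ _ → 1) ∈⊤
                                                   (λ _ y≢x → codeg-other (y≢x ∘ sym)) ⟨
      ∑∈ points (λ _ → 1) + codeg ⊤ x x            ≡⟨ cong₂ _+_ (trans (∑∈-1 points) (∣⊤∣≡n (suc (q ^ 3)))) (codeg-diag ⊤ x) ⟩
      suc (q ^ 3) + deg ⊤ x                   ≡⟨ shape₂ (deg ⊤ x) q ⟩
      q * q * q + (deg ⊤ x + 1)               ∎))
    where
    open ≡-Reasoning
    points = ⊤ {suc (q ^ 3)}
    codeg-other : ∀ {y} → x ≢ y → codeg ⊤ x y ≡ 1
    codeg-other x≢y with through x≢y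
    ... | B , xB , yB = codeg≡1 x≢y ∈⊤ xB yB
    flags : ∑∈ points (codeg ⊤ x) ≡ deg ⊤ x * suc q
    flags = trans (∑-codeg ⊤ x points) (trans
      (∑∈-cong ⊤ λ {D} _ → cong (χ (block D) x *_) (size D))
      (∑∈-*ʳ ⊤ (λ D → χ (block D) x) (suc q)))
      where
      size : ∀ D → ∑∈ points (χ (block D)) ≡ suc q
      size D = trans (∑∈-⊤ (χ (block D))) (trans (sym (sum-χ (block D))) (block-size D))
    shape₁ : ∀ a q → a * q + (a + 1) ≡ a * (1 + q) + 1
    shape₁ = solve-∀
    shape₂ : ∀ a q → 1 + q * (q * (q * 1)) + a ≡ q * q * q + (a + 1)
    shape₂ = solve-∀

  pencil : Point → Subset nb
  pencil x = tabulate λ D → lookup (block D) x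

  χ-pencil : (x : Point) (D : Block) → χ (pencil x) D ≡ χ (block D) x
  χ-pencil x D rewrite lookup∘tabulate (λ D → lookup (block D) x) D = refl

  ∈-pencil⁺ : {x : Point} {D : Block} → x ∈ block D → D ∈ pencil x
  ∈-pencil⁺ {x} {D} x∈D = lookup⇒[]= D (pencil x) (trans (lookup∘tabulate _ D) ([]=⇒lookup x∈D))

  ∈-pencil⁻ : {x : Point} {D : Block} → D ∈ pencil x → x ∈ block D
  ∈-pencil⁻ {x} {D} D∈ = lookup⇒[]= x (block D) (trans (sym (lookup∘tabulate _ D)) ([]=⇒lookup D∈))

  deg-pencil : (x y : Point) → deg (pencil x) y ≡ codeg ⊤ x y
  deg-pencil x y = trans
    (sum-cong-≗ λ D → cong (_* χ (block D) y) (χ-pencil x D))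
    (sym (∑∈-⊤ λ D → χ (block D) x * χ (block D) y))

  deg-pencil-self : (x : Point) → deg (pencil x) x ≡ q * q
  deg-pencil-self x = trans (deg-pencil x x) (trans (codeg-diag ⊤ x) (deg-⊤ x))

  deg-pencil-other : {x y : Point} → x ≢ y → deg (pencil x) y ≡ 1
  deg-pencil-other {x} {y} x≢y with through x≢y
  ... | B , xB , yB = trans (deg-pencil x y) (codeg≡1 x≢y ∈⊤ xB yB)

  -- Each of the `q + 1` points of `B` is joined to `x` by exactly one block.
  ∑-meet-pencil-∉ : {x : Point} {B : Block} → B ∉ pencil x → ∑∈ (pencil x) (meet B) ≡ suc q
  ∑-meet-pencil-∉ {x} {B} B∉ = begin
    ∑∈ (pencil x) (meet B)         ≡⟨ ∑-deg (pencil x) B ⟨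
    ∑∈ (block B) (deg (pencil x))  ≡⟨ ∑∈-cong (block B) (λ yB → deg-pencil-other λ x≡y →
                                        B∉ (∈-pencil⁺ (subst (_∈ block B) (sym x≡y) yB))) ⟩
    ∑∈ (block B) (λ _ → 1)         ≡⟨ ∑∈-1 (block B) ⟩
    ∣ block B ∣                    ≡⟨ block-size B ⟩
    suc q                          ∎
    where open ≡-Reasoning

  -- The point `x` of `B` contributes `q * q`, and each of the other `q` points contributes 1.
  ∑-meet-pencil-∈ : {x : Point} {B : Block} → B ∈ pencil x → ∑∈ (pencil x) (meet B) ≡ q * q + q
  ∑-meet-pencil-∈ {x} {B} B∈ = +-cancelʳ-≡ 1 _ _ (begin
    ∑∈ (pencil x) (meet B) + 1                 ≡⟨ cong (_+ 1) (∑-deg (pencil x) B) ⟨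
    ∑∈ (block B) (deg (pencil x)) + 1          ≡⟨ ∑∈-exchange (block B) (deg (pencil x)) (λ _ → 1) (∈-pencil⁻ B∈)
                                                    (λ _ y≢x → deg-pencil-other (y≢x ∘ sym)) ⟨
    ∑∈ (block B) (λ _ → 1) + deg (pencil x) x  ≡⟨ cong₂ _+_ (trans (∑∈-1 (block B)) (block-size B)) (deg-pencil-self x) ⟩
    suc q + q * q                              ≡⟨ shape q ⟩
    q * q + q + 1                              ∎)
    where
    open ≡-Reasoning
    shape : ∀ q → 1 + q + q * q ≡ q * q + q + 1
    shape = solve-∀

  -- Up to the diagonal term `meet B B`, this is the degree of `B` in the confluence graph.
  ∑-meet-⊤ : (B : Block) → ∑∈ ⊤ (meet B) ≡ suc q * (q * q)
  ∑-meet-⊤ B = begin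
    ∑∈ ⊤ (meet B)                ≡⟨ ∑-deg ⊤ B ⟨
    ∑∈ (block B) (deg ⊤)         ≡⟨ ∑∈-cong (block B) (λ {x} _ → deg-⊤ x) ⟩
    ∑∈ (block B) (λ _ → q * q)   ≡⟨ ∑∈-const (block B) (q * q) ⟩
    ∣ block B ∣ * (q * q)        ≡⟨ cong (_* (q * q)) (block-size B) ⟩
    suc q * (q * q)              ∎
    where open ≡-Reasoning

-- Refuting a clique with the intersection numbers of a pencil but no common point.

module CliqueWithoutCommonPoint (V : Unital) (K : Subset (Unital.nb V))
  (clique : ∀ {C D} → C ∈ K → D ∈ K → C ≢ D → Design.meet V C D ≡ 1)
  (∑-meet-∉ : ∀ {C} → C ∉ K → ∑∈ K (Design.meet V C) ≡ suc (Unital.q V))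
  (∑-meet-∈ : ∀ {C} → C ∈ K → ∑∈ K (Design.meet V C) ≡ Unital.q V * Unital.q V + Unital.q V)
  (avoiding : ∀ p → ∃ λ C → C ∈ K × p ∉ Unital.block V C)
  (q>2 : 2 < Unital.q V)
  where

  open Unital V
  open Design V

  -- By r≤1+q below, the subtraction never truncates.
  r d : Point → ℕ
  r = deg K
  d x = suc q ∸ r x

  J : Point → Point → ℕ
  J = codeg K

  different : {z x : Point} {C : Block} → z ∉ block C → x ∈ block C → z ≢ x
  different z∉C x∈C refl = z∉C x∈C

  -- If the joining block is outside `K`, the values of `r` on it add up to `q + 1`, and those at
  -- `z` and `x` are two of the terms.
  joined-or-light : {z x : Point} → z ≢ x →
    (∃ λ D → D ∈ K × z ∈ block D × x ∈ block D) ⊎ (r z + r x ≤ suc q)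
  joined-or-light z≢x with through z≢x
  ... | B , zB , xB with B ∈? K
  ...   | yes B∈K = inj₁ (B , B∈K , zB , xB)
  ...   | no  B∉K = inj₂ (≤-trans (∑∈-pair (block B) r zB xB z≢x)
                                  (≤-reflexive (trans (∑-deg K B) (∑-meet-∉ B∉K))))

  -- Each block of `K` through `z` differs from `C` and meets it in exactly one point, because `K`
  -- is a clique.
  ∑-J : {z : Point} {C : Block} → C ∈ K → z ∉ block C → ∑∈ (block C) (J z) ≡ r z
  ∑-J {z} {C} C∈K z∉C = trans (∑-codeg K z (block C)) (∑∈-cong K pointwise)
    where
    pointwise : ∀ {D} → D ∈ K → χ (block D) z * meet C D ≡ χ (block D) z
    pointwise {D} D∈K with z ∈? block D
    ... | no  z∉D rewrite χ-∉ z∉D = refl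
    ... | yes z∈D rewrite clique C∈K D∈K (λ { refl → z∉C z∈D }) = *-identityʳ _

  -- The blocks of `K` through `p` meet an avoiding block of `K` in distinct points, and that block
  -- has only `q + 1` points.
  r≤1+q : (p : Point) → r p ≤ suc q
  r≤1+q p with avoiding p
  ... | C , C∈K , p∉C = begin
    r p                        ≡⟨ ∑-J C∈K p∉C ⟨
    ∑∈ (block C) (J p)         ≤⟨ ∑∈-mono (block C) (λ x∈C → codeg≤1 {K} (different p∉C x∈C)) ⟩
    ∑∈ (block C) (λ _ → 1)     ≡⟨ ∑∈-1 (block C) ⟩
    ∣ block C ∣                ≡⟨ block-size C ⟩
    suc q                      ∎
    where open ≤-Reasoning

  r+d : (x : Point) → r x + d x ≡ suc q
  r+d x = m+[n∸m]≡n (r≤1+q x)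

  r≥1 : {x : Point} {C : Block} → C ∈ K → x ∈ block C → 1 ≤ r x
  r≥1 {x} C∈K x∈C = subst (_≤ r x) (χ-∈ x∈C) (∑∈-term K (λ D → χ (block D) x) C∈K)

  -- This is the difference between `(q + 1) * (q + 1)` and the sum `q * q + q` of `r` on `C`.
  ∑-d : {C : Block} → C ∈ K → ∑∈ (block C) d ≡ suc q
  ∑-d {C} C∈K = +-cancelˡ-≡ (q * q + q) _ _ (begin
    q * q + q + ∑∈ (block C) d             ≡⟨ cong (_+ ∑∈ (block C) d) (trans (∑-deg K C) (∑-meet-∈ C∈K)) ⟨
    ∑∈ (block C) r + ∑∈ (block C) d        ≡⟨ ∑∈-+ (block C) r d ⟨
    ∑∈ (block C) (λ x → r x + d x)         ≡⟨ ∑∈-cong (block C) (λ {x} _ → r+d x) ⟩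
    ∑∈ (block C) (λ _ → suc q)             ≡⟨ ∑∈-const (block C) (suc q) ⟩
    ∣ block C ∣ * suc q                    ≡⟨ cong (_* suc q) (block-size C) ⟩
    suc q * suc q                          ≡⟨ shape q ⟩
    q * q + q + suc q                      ∎)
    where
    open ≡-Reasoning
    shape : ∀ q → (1 + q) * (1 + q) ≡ q * q + q + (1 + q)
    shape = solve-∀

  -- If the points are joined in `K`, then `J z x` is 1 and the last summand suffices; in the light
  -- case `d x` alone does.
  r≤d+J*r : {z x : Point} → z ≢ x → r z ≤ d x + J z x * r z
  r≤d+J*r {z} {x} z≢x with joined-or-light z≢x
  ... | inj₁ (D , D∈K , zD , xD) rewrite codeg≡1 z≢x D∈K zD xD =
        ≤-trans (≤-reflexive (sym (*-identityˡ (r z)))) (m≤n+m _ (d x))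
  ... | inj₂ light = ≤-trans (+-cancelˡ-≤ (r x) _ _ (subst₂ _≤_ (+-comm (r z) (r x)) (sym (r+d x)) light))
                             (m≤m+n (d x) _)

  ∑-d+J* : {z : Point} {C : Block} (c : ℕ) → C ∈ K → z ∉ block C →
           ∑∈ (block C) (λ y → d y + J z y * c) ≡ suc q + r z * c
  ∑-d+J* {z} {C} c C∈K z∉C = trans (∑∈-+ (block C) d (λ y → J z y * c))
    (cong₂ _+_ (∑-d C∈K) (trans (∑∈-*ʳ (block C) (J z) c) (cong (_* c) (∑-J C∈K z∉C))))

  -- A point of C not joined to z by a block of K has defect at least r z, and q + 1 - r z points of C are of this kind.
  -- Adding J z y * r z to both sides avoids counting them.
  defect-bound : {z x : Point} {C : Block} → C ∈ K → z ∉ block C → x ∈ block C →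
                 suc q * r z + (d x + J z x * r z) ≤ suc q + r z * r z + r z
  defect-bound {z} {x} {C} C∈K z∉C x∈C = subst₂ _≤_
    (cong (_+ (d x + J z x * r z)) (trans (∑∈-const (block C) (r z)) (cong (_* r z) (block-size C))))
    (cong (_+ r z) (∑-d+J* (r z) C∈K z∉C))
    (∑∈-exchange-≤ (block C) (λ y → d y + J z y * r z) (λ _ → r z) x∈C
      λ y∈C _ → r≤d+J*r (different z∉C y∈C))

  -- The `q + 1` defects on a block of `K` have average 1.
  some-defect≤1 : ∃ λ x → d x ≤ 1
  some-defect≤1 =
    -- The point `zero` is arbitrary; only some block of `K` is wanted here.
    let C , C∈K , _ = avoiding zero
        x , _ , dx<2 = ∑∈-<-∃ (block C) d (λ _ → 2) (small C∈K)
    in x , ≤-pred dx<2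
    where
    small : ∀ {C} → C ∈ K → ∑∈ (block C) d < ∑∈ (block C) (λ _ → 2)
    small {C} C∈K = subst₂ _<_ (sym (∑-d C∈K))
      (sym (trans (∑∈-const (block C) 2) (cong (_* 2) (block-size C))))
      (m<m*n (suc q) 2 (s≤s (s≤s z≤n)))

  -- If `d x` were 1, then `r x` would be `q`. On a block of `K` avoiding `x`, the `q` points joined
  -- to `x` have defect at least 1 and the remaining one at least `q`, whereas the defects sum to
  -- `q + 1`, less than `q + q`.
  defect≢1 : (∀ y → 1 ≤ d y) → (x : Point) → d x ≢ 1
  defect≢1 d≥1 x dx≡1 = absurd (proj₁ (proj₂ (avoiding x))) (proj₂ (proj₂ (avoiding x)))
    where
    rx≡q : r x ≡ q
    rx≡q = +-cancelʳ-≡ 1 _ _ (trans (cong (r x +_) (sym dx≡1)) (trans (r+d x) (+-comm 1 q)))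
    -- The terms in `J x y` merge the two cases into one inequality that can be summed over the
    -- block.
    pointwise : ∀ {y} → x ≢ y → q + J x y ≤ d y + J x y * q
    pointwise {y} x≢y with joined-or-light x≢y
    ... | inj₁ (D , D∈K , xD , yD) rewrite codeg≡1 x≢y D∈K xD yD | *-identityˡ q | +-comm q 1 =
          +-monoˡ-≤ q (d≥1 y)
    ... | inj₂ light = +-mono-≤
          (+-cancelˡ-≤ (r y) _ _ (subst₂ _≤_ (trans (cong (_+ r y) rx≡q) (+-comm q (r y))) (sym (r+d y)) light))
          (m≤m*n (J x y) q {{>-nonZero (<-trans (s≤s z≤n) q>1)}})
    absurd : ∀ {C} → C ∈ K → x ∉ block C → ⊥
    absurd {C} C∈K x∉C = <⇒≱ q>1 (+-cancelˡ-≤ (q + q * q) q 1 (begin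
      q + q * q + q                                    ≡⟨ cong (λ s → s * q + q) (block-size C) ⟨
      ∣ block C ∣ * q + q                              ≡⟨ cong₂ _+_ (∑∈-const (block C) q) (trans (∑-J C∈K x∉C) rx≡q) ⟨
      ∑∈ (block C) (λ _ → q) + ∑∈ (block C) (J x)      ≡⟨ ∑∈-+ (block C) (λ _ → q) (J x) ⟨
      ∑∈ (block C) (λ y → q + J x y)                   ≤⟨ ∑∈-mono (block C) (λ y∈C → pointwise (different x∉C y∈C)) ⟩
      ∑∈ (block C) (λ y → d y + J x y * q)             ≡⟨ ∑-d+J* q C∈K x∉C ⟩
      suc q + r x * q                                  ≡⟨ cong (λ s → suc q + s * q) rx≡q ⟩
      suc q + q * q                                    ≡⟨ +-comm 1 (q + q * q) ⟩
      q + q * q + 1                                    ∎))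
      where open ≤-Reasoning

  full-point : ∃ λ p → d p ≡ 0
  full-point = decidable-stable (any? λ p → d p ≟ℕ 0) λ none →
    let d≥1 = λ x → n≢0⇒n>0 λ d≡0 → none (x , d≡0)
        x , dx≤1 = some-defect≤1
    in defect≢1 d≥1 x (≤-antisym dx≤1 (d≥1 x))

  -- Consequences of a point of defect 0.

  module WithFullPoint (p : Point) (dp≡0 : d p ≡ 0) where

    rp≡1+q : r p ≡ suc q
    rp≡1+q = trans (sym (+-identityʳ _)) (trans (cong (r p +_) (sym dp≡0)) (r+d p))

    -- As `p` has defect 0, the remaining `q` points of `C` share a total defect of `q + 1`.
    defect≥2 : {C : Block} → C ∈ K → p ∈ block C → ∃ λ z → z ∈ block C × 2 ≤ d z
    defect≥2 {C} C∈K p∈C = ∑∈-exchange-<-∃ (block C) (λ _ → 1) d p∈C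
      (≤-reflexive (trans (cong suc eqˡ) (trans (+-comm 1 (suc q)) (cong (_+ 1) (sym (∑-d C∈K))))))
      where
      eqˡ : ∑∈ (block C) (λ _ → 1) + d p ≡ suc q
      eqˡ rewrite dp≡0 = trans (+-identityʳ _) (trans (∑∈-1 (block C)) (block-size C))

    -- On a block L of K through z but not p, defect-bound for the block joining p to x shows that x ≠ z has defect 0,
    -- although the defects on L add up to q + 1 > d z.
    no-middle : (z : Point) → 2 ≤ r z → 2 ≤ d z → ⊥
    no-middle z rz≥2 dz≥2
      with separating K {z} {p} (λ { refl → contradiction (subst (2 ≤_) dp≡0 dz≥2) λ () }) rz≥2
    ... | L , L∈K , z∈L , p∉L = m+1+n≰m (d z) {0} (begin
      d z + 1             ≤⟨ +-monoʳ-≤ (d z) (≤-trans (s≤s z≤n) rz≥2) ⟩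
      d z + r z           ≡⟨ +-comm (d z) (r z) ⟩
      r z + d z           ≡⟨ r+d z ⟩
      suc q               ≡⟨ ∑-d L∈K ⟨
      ∑∈ (block L) d      ≡⟨ ∑∈-single (block L) d z∈L full ⟩
      d z                 ∎)
      where
      open ≤-Reasoning
      full : ∀ {x} → x ∈ block L → x ≢ z → d x ≡ 0
      full {x} x∈L x≢z with joined-or-light {p} {x} (different p∉L x∈L)
      ... | inj₂ light = contradiction
            (≤-trans (+-monoʳ-≤ (suc q) (r≥1 L∈K x∈L)) (subst (λ s → s + r x ≤ suc q) rp≡1+q light))
            (m+1+n≰m (suc q))
      ... | inj₁ (D , D∈K , p∈D , x∈D) = n≤0⇒n≡0 (squeeze (r z) (d z) (d x) rz≥2 dz≥2 (subst
              (λ s → s * r z + (d x + 1 * r z) ≤ s + r z * r z + r z) (sym (r+d z))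
              (subst (λ j → suc q * r z + (d x + j * r z) ≤ suc q + r z * r z + r z)
                (codeg≡1 (x≢z ∘ sym) L∈K z∈L x∈L)
                (defect-bound D∈K z∉D x∈D))))
        where
        -- Otherwise `D` and `L` would share both `x` and `z` and coincide, although `p` lies on `D`
        -- and not on `L`.
        z∉D : z ∉ block D
        z∉D z∈D = p∉L (subst (λ B → p ∈ block B) (unique x≢z x∈D z∈D x∈L z∈L) p∈D)
        -- With `r + d` in place of `q + 1`, the bound cancels to `(r - 1) * (d - 1) + e ≤ 1`, and
        -- the product is already at least 1.
        squeeze : ∀ r d e → 2 ≤ r → 2 ≤ d → (r + d) * r + (e + 1 * r) ≤ r + d + r * r + r → e ≤ 0
        squeeze r d e r≥2 d≥2 le with m≤n⇒∃[o]m+o≡n r≥2 | m≤n⇒∃[o]m+o≡n d≥2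
        ... | a , refl | b , refl = ≤-trans (m≤n+m e (a + b + a * b))
              (+-cancelˡ-≤ ((2 + a) + (2 + b) + (2 + a) * (2 + a) + (2 + a)) _ _
                (subst₂ _≤_ (shape a b e) (sym (+-identityʳ _)) le))
          where
          shape : ∀ a b e → ((2 + a) + (2 + b)) * (2 + a) + (e + 1 * (2 + a)) ≡
                  (2 + a) + (2 + b) + (2 + a) * (2 + a) + (2 + a) + (a + b + a * b + e)
          shape = solve-∀

    light : {z : Point} {C : Block} → C ∈ K → z ∈ block C → 2 ≤ d z → r z ≡ 1
    light {z} C∈K z∈C dz≥2 = ≤-antisym (≮⇒≥ λ rz≥2 → no-middle z rz≥2 dz≥2) (r≥1 C∈K z∈C)

    light⇒d≡q : {z : Point} → r z ≡ 1 → d z ≡ q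
    light⇒d≡q {z} rz≡1 = suc-injective (trans (cong (_+ d z) (sym rz≡1)) (r+d z))

    -- The point `x` has defect `q`, and `defect-bound` then forces `q ≤ 2`. This is where `q>2`
    -- enters.
    no-pair-of-light-points : {z x : Point} {C : Block} → C ∈ K → z ∉ block C → x ∈ block C →
                              r z ≡ 1 → r x ≡ 1 → ⊥
    no-pair-of-light-points {z} {x} C∈K z∉C x∈C rz≡1 rx≡1 = <⇒≱ q>2 (+-cancelˡ-≤ (suc q) q 2 (begin
      suc q + q                               ≤⟨ m≤m+n (suc q + q) (J z x) ⟩
      suc q + q + J z x                       ≡⟨ shapeˡ q (J z x) ⟩
      suc q * 1 + (q + J z x * 1)             ≤⟨ subst₂ (λ s e → suc q * s + (e + J z x * s) ≤ suc q + s * s + s)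
                                                   rz≡1 (light⇒d≡q rx≡1) (defect-bound C∈K z∉C x∈C) ⟩
      suc q + 1 * 1 + 1                       ≡⟨ shapeʳ q ⟩
      suc q + 2                               ∎))
      where
      open ≤-Reasoning
      shapeˡ : ∀ q j → 1 + q + q + j ≡ (1 + q) * 1 + (q + j * 1)
      shapeˡ = solve-∀
      shapeʳ : ∀ q → 1 + q + 1 + 1 ≡ 1 + q + 2
      shapeʳ = solve-∀

    line-through-p : ∃ λ C → C ∈ K × p ∈ block C
    line-through-p =
      let C , C∈K , 0<χ = ∑∈-<-∃ K (λ _ → 0) (λ D → χ (block D) p)
                            (subst₂ _<_ (sym (∑∈-0 K λ _ → refl)) (sym rp≡1+q) (s≤s z≤n))
      in C , C∈K , decidable-stable (p ∈? block C) λ p∉C → contradiction (subst (0 <_) (χ-∉ p∉C) 0<χ) λ ()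

    -- The first light point `z` lies on `C`; the second block `D` through `p` is chosen to miss it,
    -- as `no-pair-of-light-points` requires.
    contradictory : ⊥
    contradictory =
      let C , C∈K , p∈C        = line-through-p
          z , z∈C , dz≥2       = defect≥2 C∈K p∈C
          D , D∈K , p∈D , z∉D  = separating K (p≢ dz≥2) rp≥2
          x , x∈D , dx≥2       = defect≥2 D∈K p∈D
      in no-pair-of-light-points D∈K z∉D x∈D (light C∈K z∈C dz≥2) (light D∈K x∈D dx≥2)
      where
      p≢ : ∀ {z} → 2 ≤ d z → p ≢ z
      p≢ dz≥2 refl = contradiction (subst (2 ≤_) dp≡0 dz≥2) λ ()
      rp≥2 : 2 ≤ r p
      rp≥2 = subst (2 ≤_) (sym rp≡1+q) (s≤s (<-trans (s≤s z≤n) q>1))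

  impossible : ⊥
  impossible = WithFullPoint.contradictory (proj₁ full-point) (proj₂ full-point)

-- Whether a common point exists is decided by finite search; without one, every point is avoided by
-- some block of `K`.
clique-common-point : (V : Unital) (K : Subset (Unital.nb V)) → let open Unital V; open Design V in
  2 < q →
  (∀ {C D} → C ∈ K → D ∈ K → C ≢ D → meet C D ≡ 1) →
  (∀ {C} → C ∉ K → ∑∈ K (meet C) ≡ suc q) →
  (∀ {C} → C ∈ K → ∑∈ K (meet C) ≡ q * q + q) →
  ∃ λ p → ∀ {C} → C ∈ K → p ∈ block C
clique-common-point V K q>2 clique off on
  with any? (λ p → all? λ C → (C ∈? K) →-dec (p ∈? Unital.block V C))
... | yes (p , common) = p , λ {C} → common C
... | no  none = ⊥-elim (CliqueWithoutCommonPoint.impossible V K clique off on avoiding q>2)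
  where
  open Unital V
  avoiding : ∀ p → ∃ λ C → C ∈ K × p ∉ block C
  avoiding p =
    let C , ¬imp = ¬∀⟶∃¬ nb _ (λ C → (C ∈? K) →-dec (p ∈? block C)) (λ common → none (p , common))
    in C , decidable-stable (C ∈? K) (λ C∉K → ¬imp λ C∈K → contradiction C∈K C∉K) , λ p∈C → ¬imp λ _ → p∈C

-- Transporting pencils along a confluence isomorphism.

-- The blocks of U′ indexed by those of U along β, so that the two designs share one set of blocks.
pullback : (U U′ : Unital) (β : Unital.Block U → Unital.Block U′) → Bijective _≡_ _≡_ β → Unital
pullback U U′ β (β-inj , β-surj) = record
  { q            = U′.q
  ; q>1          = U′.q>1
  ; nb           = U.nb
  ; block        = U′.block ∘ β
  ; block-size   = U′.block-size ∘ β
  ; unique-block = λ x y x≢y →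
      let B′ , on , only = U′.unique-block x y x≢y
          B , β≡B′ = β-surj B′
          βB≡B′ = β≡B′ refl
      in B , subst (λ C → x ∈ U′.block C × y ∈ U′.block C) (sym βB≡B′) on
           , λ on-C → β-inj (trans βB≡B′ (only on-C))
  }
  where
  module U = Unital U
  module U′ = Unital U′

module ConfluenceIso (U U′ : Unital) (β : Unital.Block U → Unital.Block U′)
                     (iso : IsConfluenceIso U U′ β) where

  V : Unital
  V = pullback U U′ β (proj₁ iso)

  private
    module U = Unital U
    module U′ = Unital U′
    module DU = Design U
    module DV = Design V
    open Equivalence

  -- Distinct blocks have at most one common point, so `meet` on them just records adjacency.
  meet-preserved : ∀ {B C} → B ≢ C → DU.meet B C ≡ DV.meet B C
  meet-preserved {B} {C} B≢C
    with any? (λ x → (x ∈? U.block B) ×-dec (x ∈? U.block C))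
  ... | yes (x , xB , xC) =
        let _ , x′ , x′B , x′C = proj₂ iso B C .to (B≢C , x , xB , xC)
        in trans (DU.meet≡1 B≢C xB xC) (sym (DV.meet≡1 B≢C x′B x′C))
  ... | no disjoint = trans (DU.meet≡0 disjoint) (sym (DV.meet≡0 λ meeting →
        disjoint (proj₂ (proj₂ iso B C .from ((λ βB≡βC → B≢C (proj₁ (proj₁ iso) βB≡βC)) , meeting)))))

  -- Degrees are compared at a vertex, so one has to exist: the number of blocks through the point
  -- `zero` is positive.
  some-block : U.Block
  some-block = proj₁ (∑∈-<-∃ ⊤ (λ _ → 0) (λ D → χ (U.block D) zero)
    (subst₂ _<_ (sym (∑∈-0 (⊤ {U.nb}) λ _ → refl)) (sym (DU.deg-⊤ zero)) (*-mono-< 0<q 0<q)))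
    where
    0<q : 0 < U.q
    0<q = <-trans (s≤s z≤n) U.q>1

  -- The sums of `meet` over all blocks differ only in the term at `some-block` itself, which is
  -- `suc U.q` or `suc U′.q`. This equates the degrees, of the form `(n + 1) * (n * n - 1)`, without
  -- subtraction.
  degree-eq : suc U′.q * (U′.q * U′.q) + suc U.q ≡ suc U.q * (U.q * U.q) + suc U′.q
  degree-eq = subst₂ _≡_
    (cong₂ _+_ (DV.∑-meet-⊤ some-block) (DU.meet-diag some-block))
    (cong₂ _+_ (DU.∑-meet-⊤ some-block) (DV.meet-diag some-block))
    (∑∈-exchange ⊤ (DU.meet some-block) (DV.meet some-block) ∈⊤ λ _ C≢B → meet-preserved (C≢B ∘ sym))

  same-order : U.q ≡ U′.q
  same-order = degree-injective U.q U′.q (<-trans (s≤s z≤n) U.q>1) (<-trans (s≤s z≤n) U′.q>1) degree-eq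
    where
    -- The degree `(n + 1) * (n * n - 1)` is strictly increasing in positive `n`; the subtracted
    -- terms are moved across.
    monotone : ∀ a b → 0 < a → a < b → suc a * (a * a) + suc b < suc b * (b * b) + suc a
    monotone a b 0<a a<b = begin-strict
      suc a * (a * a) + suc b    ≤⟨ +-mono-≤ (*-mono-≤ a<b (*-mono-≤ (<⇒≤ a<b) (<⇒≤ a<b)))
                                            (+-monoʳ-≤ 1 (m≤m*n b b {{>-nonZero (<-trans 0<a a<b)}})) ⟩
      b * (b * b) + suc (b * b)  <⟨ +-monoʳ-< (b * (b * b)) (m<m+n (suc (b * b)) 0<a) ⟩
      b * (b * b) + (suc (b * b) + a) ≡⟨ shape b a ⟩
      suc b * (b * b) + suc a    ∎
      where
      open ≤-Reasoning
      shape : ∀ b a → b * (b * b) + (1 + b * b + a) ≡ (1 + b) * (b * b) + (1 + a)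
      shape = solve-∀
    degree-injective : ∀ a b → 0 < a → 0 < b → suc b * (b * b) + suc a ≡ suc a * (a * a) + suc b → a ≡ b
    degree-injective a b 0<a 0<b eq with <-cmp a b
    ... | tri< a<b _ _ = contradiction (sym eq) (<⇒≢ (monotone a b 0<a a<b))
    ... | tri≈ _ a≡b _ = a≡b
    ... | tri> _ _ b<a = contradiction eq (<⇒≢ (monotone b a 0<b b<a))

  -- Once the orders agree, so do the diagonal values of `meet`; hence the image of a pencil has the
  -- intersection numbers of a pencil.
  pencil-image : 2 < U.q → (x : U.Point) → ∃ λ x′ → ∀ {B} → x ∈ U.block B → x′ ∈ U′.block (β B)
  pencil-image q>2 x =
    let x′ , common = clique-common-point V (DU.pencil x) (subst (2 <_) same-order q>2) clique off on
    in x′ , common ∘ DU.∈-pencil⁺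
    where
    same-meet : ∀ B C → DV.meet B C ≡ DU.meet B C
    same-meet B C with B ≟ C
    ... | yes refl = trans (DV.meet-diag B) (trans (cong suc (sym same-order)) (sym (DU.meet-diag B)))
    ... | no  B≢C  = sym (meet-preserved B≢C)
    ∑-same : ∀ C → ∑∈ (DU.pencil x) (DV.meet C) ≡ ∑∈ (DU.pencil x) (DU.meet C)
    ∑-same C = ∑∈-cong (DU.pencil x) λ {D} _ → same-meet C D
    clique : ∀ {C D} → C ∈ DU.pencil x → D ∈ DU.pencil x → C ≢ D → DV.meet C D ≡ 1
    clique C∈ D∈ C≢D = trans (same-meet _ _) (DU.meet≡1 C≢D (DU.∈-pencil⁻ C∈) (DU.∈-pencil⁻ D∈))
    off : ∀ {C} → C ∉ DU.pencil x → ∑∈ (DU.pencil x) (DV.meet C) ≡ suc U′.q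
    off {C} C∉ = trans (∑-same C) (trans (DU.∑-meet-pencil-∉ C∉) (cong suc same-order))
    on : ∀ {C} → C ∈ DU.pencil x → ∑∈ (DU.pencil x) (DV.meet C) ≡ U′.q * U′.q + U′.q
    on {C} C∈ = trans (∑-same C) (trans (DU.∑-meet-pencil-∈ C∈) (cong (λ q → q * q + q) same-order))

-- Recovering the points from their pencils.

-- At least two blocks pass through `x`, and a point other than `x` misses one of them.
point-determined : (U : Unital) → let open Unital U in
  {x y : Point} → (∀ {B} → x ∈ block B → y ∈ block B) → y ≡ x
point-determined U {x} {y} x∈⇒y∈ = decidable-stable (y ≟ x) λ y≢x →
  let _ , _ , x∈C , y∉C = separating ⊤ (y≢x ∘ sym) deg≥2 in y∉C (x∈⇒y∈ x∈C)
  where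
  open Unital U
  open Design U
  deg≥2 : 2 ≤ deg ⊤ x
  deg≥2 = subst (2 ≤_) (sym (deg-⊤ x)) (≤-trans (m≤m*n 2 2) (*-mono-≤ q>1 q>1))

theorem2p3 : (U U' : Unital) → 2 < Unital.q U →
    (β : Unital.Block U → Unital.Block U') → IsConfluenceIso U U' β →
    Σ (Unital.Point U → Unital.Point U') (λ α → IsIncidenceIso U U' α β)
theorem2p3 U U' q>2 β iso@((β-inj , β-surj) , β-adj) =
  α , (α-inj , λ x′ → α⁻¹ x′ , λ { refl → α∘α⁻¹ x′ })
    , (β-inj , β-surj)
    -- For the converse, the incidence is carried back by `α⁻¹` and `β⁻¹`.
    , λ x B → mk⇔ α-∈ λ αx∈βB → subst₂ (λ y C → y ∈ U.block C) (α⁻¹∘α x) (β⁻¹∘β B) (α⁻¹-∈ αx∈βB)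
  where
  module U = Unital U
  module U′ = Unital U'
  open Equivalence

  β⁻¹ : U′.Block → U.Block
  β⁻¹ B′ = proj₁ (β-surj B′)

  β∘β⁻¹ : ∀ B′ → β (β⁻¹ B′) ≡ B′
  β∘β⁻¹ B′ = proj₂ (β-surj B′) refl

  β⁻¹∘β : ∀ B → β⁻¹ (β B) ≡ B
  β⁻¹∘β B = β-inj (β∘β⁻¹ (β B))

  iso⁻¹ : IsConfluenceIso U' U β⁻¹
  iso⁻¹ =
    ( (λ {B′} {C′} eq → trans (sym (β∘β⁻¹ B′)) (trans (cong β eq) (β∘β⁻¹ C′)))
    , (λ B → β B , λ { refl → β⁻¹∘β B }) )
    , λ B′ C′ → mk⇔
        (λ adj → β-adj (β⁻¹ B′) (β⁻¹ C′) .from (subst₂ U′.Adj (sym (β∘β⁻¹ B′)) (sym (β∘β⁻¹ C′)) adj))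
        (λ adj → subst₂ U′.Adj (β∘β⁻¹ B′) (β∘β⁻¹ C′) (β-adj (β⁻¹ B′) (β⁻¹ C′) .to adj))

  q′>2 : 2 < U′.q
  q′>2 = subst (2 <_) (ConfluenceIso.same-order U U' β iso) q>2

  α : U.Point → U′.Point
  α x = proj₁ (ConfluenceIso.pencil-image U U' β iso q>2 x)

  α-∈ : ∀ {x B} → x ∈ U.block B → α x ∈ U′.block (β B)
  α-∈ {x} = proj₂ (ConfluenceIso.pencil-image U U' β iso q>2 x)

  α⁻¹ : U′.Point → U.Point
  α⁻¹ x′ = proj₁ (ConfluenceIso.pencil-image U' U β⁻¹ iso⁻¹ q′>2 x′)

  α⁻¹-∈ : ∀ {x′ B′} → x′ ∈ U′.block B′ → α⁻¹ x′ ∈ U.block (β⁻¹ B′)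
  α⁻¹-∈ {x′} = proj₂ (ConfluenceIso.pencil-image U' U β⁻¹ iso⁻¹ q′>2 x′)

  -- By construction `α⁻¹ (α x)` lies on every block through `x`, which leaves only `x` itself.
  α⁻¹∘α : ∀ x → α⁻¹ (α x) ≡ x
  α⁻¹∘α x = point-determined U λ {B} x∈B →
    subst (λ C → α⁻¹ (α x) ∈ U.block C) (β⁻¹∘β B) (α⁻¹-∈ (α-∈ x∈B))

  α∘α⁻¹ : ∀ x′ → α (α⁻¹ x′) ≡ x′
  α∘α⁻¹ x′ = point-determined U' λ {B′} x′∈B′ →
    subst (λ C → α (α⁻¹ x′) ∈ U′.block C) (β∘β⁻¹ B′) (α-∈ (α⁻¹-∈ x′∈B′))

  α-inj : ∀ {x y} → α x ≡ α y → x ≡ y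
  α-inj {x} {y} eq = trans (sym (α⁻¹∘α x)) (trans (cong α⁻¹ eq) (α⁻¹∘α y))
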